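{- For every integer $n \geq 2$ and every $k \in \mathbb{N}_{+}$, there is a transparent strategy for Presenter in the $n$-round, $k$-bounded on-line graph coloring game that forces Algorithm to use at least $2\frac{n}{\log n + 3}$ different colors, and in which Presenter's own (transparent) coloring uses at most $\frac{n}{k} + \log n + 3$ colors. Here $\log$ denotes the logarithm to base $2$.
   Context: A proper coloring of a graph $G$ assigns colors to the vertices so that adjacent vertices receive distinct colors. A $k$-bounded coloring of $G$ is a proper coloring in which each single color is assigned to at most $k$ vertices. The $n$-round, $k$-bounded on-line graph coloring game is played by two players, Presenter and Algorithm, for $n$ rounds. In each round Presenter introduces a new vertex of a graph together with its adjacency status to all vertices presented earlier. Algorithm then irrevocably assigns a color to the new vertex, before the next vertex is introduced, in such a way that the coloring of the presented graph constructed by Algorithm is a $k$-bounded coloring. Algorithm may use any number of colors and aims to minimize the number of different colors used. A strategy for Presenter is transparent if, each time after Algorithm assigns a color to a vertex, Presenter also irrevocably colors that vertex with a color of his own and reveals that color to Algorithm; the coloring constructed by Presenter must satisfy the same conditions as the coloring constructed by Algorithm (that is, it must be a $k$-bounded coloring of the presented graph). A strategy for Presenter "forces Algorithm to use at least $c$ colors" if, whatever valid choices Algorithm makes, at the end of the game played against this strategy Algorithm has used at least $c$ different colors. -}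

module Defs where

open import Data.Empty using (⊥)
open import Data.Fin.Base using (Fin; zero; suc)
open import Data.Fin.Subset using (Subset; _∈_)
open import Data.Integer.Base using (+_; -[1+_])
open import Data.List.Base using (length; deduplicate)
open import Data.Nat.Base as ℕ using (ℕ; zero; suc)
open import Data.Nat.Properties using (_≟_)
open import Data.Product.Base using (_×_)
open import Data.Rational.Unnormalised.Base
  using (ℚᵘ; mkℚᵘ; _/_; _≤_; _+_; _*_; _÷_; NonZero; NonNegative; Positive)
open import Data.Rational.Unnormalised.Properties using (pos⇒nonZero)
open import Data.Vec.Base using (Vec; []; _∷_; lookup; count; toList)
open import Relation.Binary.PropositionalEquality using (_≢_)

-- A finite simple graph together with the order in which its vertices were
-- presented.  In G ▹ N the new vertex has neighbourhood N among the earlier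
-- ones.  The newest vertex is numbered zero and every older vertex is shifted
-- up by one, so that a colouring is extended by _∷_.

data Graph : ℕ → Set where
  ∅   : Graph 0
  _▹_ : ∀ {m} → Graph m → Subset m → Graph (suc m)

infixl 5 _▹_

Adjacent : ∀ {m} → Graph m → Fin m → Fin m → Set
Adjacent (G ▹ N) zero    zero    = ⊥
Adjacent (G ▹ N) zero    (suc j) = j ∈ N
Adjacent (G ▹ N) (suc i) zero    = i ∈ N
Adjacent (G ▹ N) (suc i) (suc j) = Adjacent G i j

Colouring : ℕ → Set
Colouring m = Vec ℕ m

Proper : ∀ {m} → Graph m → Colouring m → Set
Proper G c = ∀ i j → Adjacent G i j → lookup c i ≢ lookup c j

KBounded : ∀ {m} → ℕ → Graph m → Colouring m → Set
KBounded k G c = Proper G c × (∀ colour → count (colour ≟_) c ℕ.≤ k)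

numColours : ∀ {m} → Colouring m → ℕ
numColours c = length (deduplicate _≟_ (toList c))

-- The situation after m rounds.  It determines the whole history of the game.

record Position (m : ℕ) : Set where
  constructor position
  field
    graph     : Graph m
    algorithm : Colouring m
    presenter : Colouring m

open Position public

-- present gives the neighbourhood of the next vertex; reply gives Presenter's
-- own colour for it, chosen after seeing the colour assigned by Algorithm.

record Strategy : Set where
  field
    present : ∀ {m} → Position m → Subset m
    reply   : ∀ {m} → Position m → ℕ → ℕ

open Strategy public

initial : Position 0
initial = position ∅ [] []

next : ∀ {m} → Strategy → Position m → ℕ → Position (suc m)
next σ P a = position (graph P ▹ present σ P)
                      (a ∷ algorithm P)
                      (reply σ P a ∷ presenter P)

-- Play k σ P: the position P can arise when Presenter follows σ and Algorithm
-- makes arbitrary valid moves.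

data Play (k : ℕ) (σ : Strategy) : ∀ {m} → Position m → Set where
  start : Play k σ initial
  round : ∀ {m} {P : Position m} → Play k σ P → (a : ℕ) →
          KBounded k (graph P ▹ present σ P) (a ∷ algorithm P) →
          Play k σ (next σ P a)

-- The values of a strategy beyond round n are irrelevant, so validity of
-- Presenter's colouring is only required during the first n rounds.

record TransparentStrategy (n k : ℕ) : Set where
  field
    strategy : Strategy
    valid    : ∀ {m} {P : Position m} → m ℕ.≤ n → Play k strategy P →
               KBounded k (graph P) (presenter P)

open TransparentStrategy public

-- The real number log₂ n is given by its upper cut in the rationals:
-- log₂ n ≤ a/b  iff  n ≤ 2^(a/b)  iff  n^b ≤ 2^a.

log₂_≤_ : ℕ → ℚᵘ → Set
log₂ n ≤ mkℚᵘ (+ a)    b-1 = n ℕ.^ suc b-1 ℕ.≤ 2 ℕ.^ a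
log₂ n ≤ mkℚᵘ -[1+ a ] b-1 = n ℕ.^ suc b-1 ℕ.* 2 ℕ.^ suc a ℕ.≤ 1

fromℕ : ℕ → ℚᵘ
fromℕ m = + m / 1

nonNeg+3-nonZero : ∀ q → .{{NonNegative q}} → NonZero (q + fromℕ 3)
nonNeg+3-nonZero q = pos⇒nonZero (q + fromℕ 3) {{positive q}}
  where
  positive : ∀ p → .{{NonNegative p}} → Positive (p + fromℕ 3)
  positive (mkℚᵘ (+ zero)  _) = _
  positive (mkℚᵘ (+ suc _) _) = _

-- The two bounds with a rational q in place of log₂ n.

algorithmBound : ℕ → (q : ℚᵘ) → .{{NonNegative q}} → ℚᵘ
algorithmBound n q = fromℕ 2 * ((fromℕ n ÷ (q + fromℕ 3)) {{nonNeg+3-nonZero q}})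

presenterBound : (n k : ℕ) → .{{ℕ.NonZero k}} → ℚᵘ → ℚᵘ
presenterBound n k q = + n / k + q + fromℕ 3

-- AlgorithmAtLeast n c is c ≥ 2n/(log₂ n + 3) and PresenterAtMost n k c is
-- c ≤ n/k + log₂ n + 3, as inequalities between reals.  Both are non-strict,
-- both bounds are continuous in the logarithm and both inequalities become
-- weaker as it grows, while log₂ n (nonnegative for n ≥ 1) is the infimum of
-- its rational upper bounds.  Hence each inequality holds iff it holds with
-- every such upper bound q in place of log₂ n.

AlgorithmAtLeast : (n c : ℕ) → Set
AlgorithmAtLeast n c =
  ∀ q → .{{_ : NonNegative q}} → log₂ n ≤ q → algorithmBound n q ≤ fromℕ c

PresenterAtMost : (n k : ℕ) → .{{ℕ.NonZero k}} → (c : ℕ) → Set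
PresenterAtMost n k c =
  ∀ q → .{{_ : NonNegative q}} → log₂ n ≤ q → fromℕ c ≤ presenterBound n k q

{-# OPTIONS --safe #-}

-- Presenter plays with the ⌊n/k⌋ + 2s colours 0, 1, 2, …, where
-- 2n ≤ 4^s ≤ 8n.  At most ⌊n/k⌋ of them are ever used up, so in each round he
-- can choose a menu of s colours among 2s colours that can still be used, and
-- join the new vertex to all vertices whose (Presenter) colour is not on the
-- menu.  The hues of an Algorithm colour class that may receive the new vertex
-- are then on the menu, and if they do not exhaust it, Presenter picks a new
-- hue from it; so the hues in each class stay distinct, and no class exceeds
-- s vertices.  A suitable menu exists because a class exhausts at most one
-- menu, and only if it has s vertices, while 2s (2s choose s) ≥ 4^s ≥ 2n.
-- Both bounds follow from 2s ≤ log₂ n + 3, that is, 4^s ≤ 8n.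

module Submission where

open import Defs
open import Data.Nat.Properties
open import Algebra.Properties.CommutativeSemigroup +-commutativeSemigroup using (x∙yz≈y∙xz)
open import Data.Bool.Base using (true; false; not)
open import Data.Fin.Base using (zero; suc)
import Data.Fin.Subset as Subset
open import Data.Integer.Base as ℤ using (+≤+)
import Data.Integer.Properties as ℤ
open import Data.List.Base as List
  using (List; []; _∷_; _++_; length; map; filter; take; upTo)
open import Data.List.Properties
  using (length-map; length-++; length-take; length-upTo; filter-all; filter-some; ∷-injectiveʳ)
open import Data.List.Membership.Propositional using (_∈_; _∉_; find; lose)
open import Data.List.Membership.DecPropositional _≟_ using (_∈?_)
open import Data.List.Membership.Propositional.Properties
  using (∈-filter⁻; ∈-upTo⁺; ∈-upTo⁻; ∈-map⁻; ∈-deduplicate⁺; ∈-deduplicate⁻)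
open import Data.List.Relation.Binary.Disjoint.Propositional using (Disjoint)
open import Data.List.Relation.Binary.Pointwise using (Pointwise-≡⇒≡)
open import Data.List.Relation.Binary.Sublist.Propositional as Sublist
  using (_⊆_; []; _∷_; _∷ʳ_; minimum)
open import Data.List.Relation.Binary.Sublist.Propositional.Properties
  using (length-mono-≤; to-≋; filter⁺; take-⊆)
open import Data.List.Relation.Unary.All as All using (All; []; _∷_; all?)
import Data.List.Relation.Unary.All.Properties as All
open import Data.List.Relation.Unary.AllPairs using ([]; _∷_)
open import Data.List.Relation.Unary.Any as Any using (Any; here; there; any?)
open import Data.List.Relation.Unary.Unique.DecPropositional.Properties using (deduplicate-!)
open import Data.List.Relation.Unary.Unique.Propositional using (Unique)
import Data.List.Relation.Unary.Unique.Propositional.Properties as Unique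
open import Data.Maybe.Base using (fromMaybe)
open import Data.Nat.Base
open import Data.Nat.Combinatorics using (_C_; nCk≡nC[n∸k]; nCn≡1; nCk+nC[k+1]≡[n+1]C[k+1])
open import Data.Nat.DivMod using (_/_; m/n*n≤m; m*n/n≡m; /-monoˡ-≤)
open import Data.Nat.ListAction using (sum)
open import Data.Nat.Tactic.RingSolver using (solve-∀)
open import Data.Product.Base using (_×_; _,_; proj₁; proj₂; Σ-syntax; ∃-syntax)
open import Data.Rational.Unnormalised.Base as ℚ using (mkℚᵘ; *≤*)
import Data.Rational.Unnormalised.Properties as ℚ
open import Data.Vec.Base as Vec using (Vec; []; _∷_; lookup; count; toList; fromList)
open import Data.Vec.Properties using (lookup-map; []=⇒lookup; lookup⇒[]=)
open import Data.Vec.Membership.Propositional.Properties using (∈-lookup; ∈-toList⁺)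
open import Function.Base using (_∘_; case_of_)
open import Level using (Level)
open import Relation.Binary.PropositionalEquality
open import Relation.Nullary.Decidable using (yes; no; does; ¬?; decidable-stable; dec-true; dec-false)
open import Relation.Nullary.Negation using (¬_; contradiction)
open import Relation.Unary using (Pred; Decidable)

private
  variable
    ℓ : Level
    A B : Set
    m : ℕ

-- Double counting

count-accept : ∀ {P : Pred A ℓ} (P? : Decidable P) {x} (xs : Vec A m) → P x → count P? (x ∷ xs) ≡ suc (count P? xs)
count-accept P? {x} xs px with P? x
... | yes _  = refl
... | no ¬px = contradiction px ¬px

count-reject : ∀ {P : Pred A ℓ} (P? : Decidable P) {x} (xs : Vec A m) → ¬ P x → count P? (x ∷ xs) ≡ count P? xs
count-reject P? {x} xs ¬px with P? x
... | yes px = contradiction px ¬px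
... | no _   = refl

occurrences : List ℕ → Vec ℕ m → ℕ
occurrences L c = sum (map (λ a → count (a ≟_) c) L)

-- This exchanges the order of summation: `occurrences` sums over the list, the recursion here runs
-- over the entries of the vector. The two size bounds then only need that an entry occurs in `L` at
-- most once, respectively at least once.
occurrences-∷ : ∀ L x (c : Vec ℕ m) →
  occurrences L (x ∷ c) ≡ length (filter (_≟ x) L) + occurrences L c
occurrences-∷ []      x c = refl
occurrences-∷ (a ∷ L) x c with ih ← occurrences-∷ L x c | does (a ≟ x)
... | true  = cong suc (trans (cong (λ i → count (a ≟_) c + i) ih) (x∙yz≈y∙xz (count (a ≟_) c) (length (filter (_≟ x) L)) (occurrences L c)))
... | false = trans (cong (λ i → count (a ≟_) c + i) ih) (x∙yz≈y∙xz (count (a ≟_) c) (length (filter (_≟ x) L)) (occurrences L c))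

length-filter-≟≤1 : ∀ {L} x → Unique L → length (filter (_≟ x) L) ≤ 1
length-filter-≟≤1 {L} x L! = atMostOne (Unique.filter⁺ (_≟ x) L!) (All.all-filter (_≟ x) L)
  where
  atMostOne : ∀ {M} → Unique M → All (_≡ x) M → length M ≤ 1
  atMostOne {[]}        _ _ = z≤n
  atMostOne {_ ∷ []}    _ _ = ≤-refl
  atMostOne {_ ∷ _ ∷ _} ((a≢b ∷ _) ∷ _) (refl ∷ refl ∷ _) = contradiction refl a≢b

occurrences≤size : ∀ {L} (c : Vec ℕ m) → Unique L → occurrences L c ≤ m
occurrences≤size {L = L} [] _ = ≤-reflexive (zeros L)
  where
  zeros : ∀ L → occurrences L [] ≡ 0
  zeros []      = refl
  zeros (_ ∷ L) = zeros L
occurrences≤size {L = L} (x ∷ c) L! = begin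
  occurrences L (x ∷ c)                           ≡⟨ occurrences-∷ L x c ⟩
  length (filter (_≟ x) L) + occurrences L c      ≤⟨ +-mono-≤ (length-filter-≟≤1 x L!) (occurrences≤size c L!) ⟩
  suc _                                           ∎
  where open ≤-Reasoning

size≤occurrences : ∀ {L} (c : Vec ℕ m) → (∀ i → lookup c i ∈ L) → m ≤ occurrences L c
size≤occurrences []      _ = z≤n
size≤occurrences {L = L} (x ∷ c) c⊆L = begin
  suc _                                           ≤⟨ +-mono-≤ (filter-some (_≟ x) (Any.map sym (c⊆L zero))) (size≤occurrences c (c⊆L ∘ suc)) ⟩
  length (filter (_≟ x) L) + occurrences L c      ≡⟨ occurrences-∷ L x c ⟨
  occurrences L (x ∷ c)                           ∎
  where open ≤-Reasoning

-- It serves with `t = k` for the colours Presenter has used up, with `t = s` for the full classes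
-- of Algorithm, and with `t = 1` for comparing lengths of lists.
pigeonhole-≥ : ∀ {L t} (c : Vec ℕ m) → Unique L → All (λ a → t ≤ count (a ≟_) c) L → length L * t ≤ m
pigeonhole-≥ {m} {t = t} c L! t≤ = ≤-trans (go t≤) (occurrences≤size c L!)
  where
  go : ∀ {L} → All (λ a → t ≤ count (a ≟_) c) L → length L * t ≤ occurrences L c
  go []       = z≤n
  go (p ∷ ps) = +-mono-≤ p (go ps)

pigeonhole-≤ : ∀ L {t} (c : Vec ℕ m) → (∀ i → lookup c i ∈ L) → (∀ a → count (a ≟_) c ≤ t) → m ≤ length L * t
pigeonhole-≤ L {t} c c⊆L ≤t = ≤-trans (size≤occurrences c c⊆L) (go L)
  where
  go : ∀ L → occurrences L c ≤ length L * t
  go []      = z≤n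
  go (a ∷ L) = +-mono-≤ (≤t a) (go L)

any⇒1≤count : ∀ {P : Pred A ℓ} (P? : Decidable P) {xs} → Any P xs → 1 ≤ count P? (fromList xs)
any⇒1≤count P? {x ∷ xs} any with P? x | any
... | yes _  | _         = s≤s z≤n
... | no ¬px | here px   = contradiction px ¬px
... | no _   | there pxs = any⇒1≤count P? pxs

unique⇒length≤ : ∀ {L M} → Unique L → All (_∈ M) L → length L ≤ length M
unique⇒length≤ {L} {M} L! L⊆M = begin
  length L     ≡⟨ *-identityʳ (length L) ⟨
  length L * 1 ≤⟨ pigeonhole-≥ (fromList M) L! (All.map (any⇒1≤count (_ ≟_)) L⊆M) ⟩
  length M     ∎
  where open ≤-Reasoning

-- Sublists of a given length

choose : ℕ → List A → List (List A)
choose zero    xs       = [] ∷ []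
choose (suc s) []       = []
choose (suc s) (x ∷ xs) = map (x ∷_) (choose s xs) ++ choose (suc s) xs

length-choose : ∀ s (xs : List A) → length (choose s xs) ≡ length xs C s
length-choose zero    xs       = sym (trans (nCk≡nC[n∸k] {0} {length xs} z≤n) (nCn≡1 (length xs)))
length-choose (suc s) []       = refl
length-choose (suc s) (x ∷ xs) = begin
  length (map (x ∷_) (choose s xs) ++ choose (suc s) xs)          ≡⟨ length-++ (map (x ∷_) (choose s xs)) ⟩
  length (map (x ∷_) (choose s xs)) + length (choose (suc s) xs)  ≡⟨ cong₂ _+_ (trans (length-map (x ∷_) (choose s xs)) (length-choose s xs)) (length-choose (suc s) xs) ⟩
  length xs C s + length xs C suc s                               ≡⟨ nCk+nC[k+1]≡[n+1]C[k+1] (length xs) s ⟩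
  suc (length xs) C suc s                                         ∎
  where open ≡-Reasoning

choose-sublists : ∀ s (xs : List A) → All (λ ys → ys ⊆ xs × length ys ≡ s) (choose s xs)
choose-sublists zero    xs       = (minimum xs , refl) ∷ []
choose-sublists (suc s) []       = []
choose-sublists (suc s) (x ∷ xs) = All.++⁺
  (All.map⁺ (All.map (λ (ys⊆xs , eq) → refl ∷ ys⊆xs , cong suc eq) (choose-sublists s xs)))
  (All.map (λ (ys⊆xs , eq) → x ∷ʳ ys⊆xs , eq) (choose-sublists (suc s) xs))

-- Lists of the first half begin with `x`, while those of the second half are sublists of `xs`,
-- where `x` does not occur. Hence the binomial coefficient counts distinct menus.
choose-! : ∀ s {xs : List A} → Unique xs → Unique (choose s xs)
choose-! zero    _ = [] ∷ []
choose-! (suc s) [] = []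
choose-! (suc s) {x ∷ xs} (x∉xs ∷ xs!) =
  Unique.++⁺ (Unique.map⁺ ∷-injectiveʳ (choose-! s xs!)) (choose-! (suc s) xs!) disjoint
  where
  disjoint : Disjoint (map (x ∷_) (choose s xs)) (choose (suc s) xs)
  disjoint (∈map , ∈choose) with _ , _ , refl ← ∈-map⁻ (x ∷_) ∈map =
    All.lookup x∉xs (Sublist.lookup (proj₁ (All.lookup (choose-sublists (suc s) xs) ∈choose)) (here refl)) refl

-- `ys` is a sublist of the filtered list, which is duplicate-free and contained in `H`, hence no
-- longer than `ys`; a sublist of equal length is the whole list. So a class with few enough hues
-- determines the only menu it can exhaust.
sublist≡filter : ∀ {xs ys H} → Unique xs → ys ⊆ xs → All (_∈ H) ys → length H ≤ length ys →
  ys ≡ filter (λ x → x ∈? H) xs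
sublist≡filter {xs} {ys} {H} xs! ys⊆xs ys⊆H H≤ys = Pointwise-≡⇒≡ (to-≋ (≤-antisym (length-mono-≤ ys⊆) short) ys⊆)
  where
  ∈H? : Decidable (_∈ H)
  ∈H? x = x ∈? H
  ys⊆ : ys ⊆ filter ∈H? xs
  ys⊆ = subst (_⊆ filter ∈H? xs) (filter-all ∈H? ys⊆H) (filter⁺ ∈H? ∈H? (λ { refl p → p }) ys⊆xs)
  short : length (filter ∈H? xs) ≤ length ys
  short = ≤-trans (unique⇒length≤ (Unique.filter⁺ ∈H? xs!) (All.all-filter ∈H? xs)) H≤ys

-- Choice along a list. Since the witnesses are kept as a list with image `ys`, distinctness of `ys`
-- can be pulled back to them.
All-∃-map : ∀ {P : Pred A ℓ} {g : A → B} {ys} → All (λ y → ∃[ x ] (g x ≡ y × P x)) ys →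
  ∃[ xs ] (map g xs ≡ ys × All P xs)
All-∃-map []                      = [] , refl , []
All-∃-map ((x , refl , px) ∷ pys) with xs , refl , pxs ← All-∃-map pys = x ∷ xs , refl , px ∷ pxs

-- The fallback `d` keeps the search total, because a strategy has to answer at every position,
-- including those where no candidate is suitable.
pick : {P : Pred A ℓ} → Decidable P → A → List A → A
pick P? d xs = fromMaybe d (List.find P? xs)

pick-sat : ∀ {P : Pred A ℓ} (P? : Decidable P) d {xs} → Any P xs → pick P? d xs ∈ xs × P (pick P? d xs)
pick-sat P? d {x ∷ xs} any with P? x | any
... | yes px | _         = here refl , px
... | no ¬px | here px   = contradiction px ¬px
... | no _   | there pxs with ∈xs , p ← pick-sat P? d pxs = there ∈xs , p

length-filter-¬ : ∀ {P : Pred A ℓ} (P? : Decidable P) xs →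
  length (filter P? xs) + length (filter (¬? ∘ P?) xs) ≡ length xs
length-filter-¬ P? []       = refl
length-filter-¬ P? (x ∷ xs) with ih ← length-filter-¬ P? xs | P? x
... | yes _ = cong suc ih
... | no  _ = trans (+-suc _ _) (cong suc ih)

-- Central binomial coefficients and powers

-- Both sides count the `suc k`-element subsets of a `suc n`-element set with one marked element.
-- The proof is by induction with Pascal's rule and avoids division.
absorption : ∀ n k → suc k * (suc n C suc k) ≡ suc n * (n C k)
absorption zero zero = refl
absorption zero (suc k) = *-zeroʳ (suc (suc k))
absorption (suc n) zero = begin
  1 * (suc (suc n) C 1)           ≡⟨ cong (1 *_) (nCk+nC[k+1]≡[n+1]C[k+1] (suc n) 0) ⟨
  1 * (1 + suc n C 1)             ≡⟨ *-distribˡ-+ 1 1 (suc n C 1) ⟩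
  1 + 1 * (suc n C 1)             ≡⟨ cong (1 +_) (absorption n 0) ⟩
  1 + suc n * 1                   ∎
  where open ≡-Reasoning
absorption (suc n) (suc k) = begin
  suc (suc k) * (suc (suc n) C suc (suc k))
    ≡⟨ cong (suc (suc k) *_) (nCk+nC[k+1]≡[n+1]C[k+1] (suc n) (suc k)) ⟨
  suc (suc k) * (c + suc n C suc (suc k))
    ≡⟨ *-distribˡ-+ (suc (suc k)) c _ ⟩
  c + suc k * c + suc (suc k) * (suc n C suc (suc k))
    ≡⟨ cong₂ (λ x y → c + x + y) (absorption n k) (absorption n (suc k)) ⟩
  c + suc n * (n C k) + suc n * (n C suc k)
    ≡⟨ +-assoc c _ _ ⟩
  c + (suc n * (n C k) + suc n * (n C suc k))
    ≡⟨ cong (c +_) (*-distribˡ-+ (suc n) (n C k) (n C suc k)) ⟨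
  c + suc n * (n C k + n C suc k)
    ≡⟨ cong (λ x → c + suc n * x) (nCk+nC[k+1]≡[n+1]C[k+1] n k) ⟩
  suc (suc n) * c ∎
  where
  open ≡-Reasoning
  c = suc n C suc k

-- Two absorptions lead down from row `2s + 2` to row `2s`, with the symmetry of row `2s + 1` in
-- between. The factor `suc (suc (s + s))` left by the first is twice the factor `suc s` consumed by
-- the second.
centralBinomial-suc : ∀ s → suc s * ((suc s + suc s) C suc s) ≡ 2 * (suc (s + s) * ((s + s) C s))
centralBinomial-suc s = *-cancelˡ-≡ _ _ (suc s) (begin
  suc s * (suc s * ((suc s + suc s) C suc s))      ≡⟨ cong (λ x → suc s * (suc s * (suc x C suc s))) (+-suc s s) ⟩
  suc s * (suc s * (suc (suc (s + s)) C suc s))    ≡⟨ cong (suc s *_) (absorption (suc (s + s)) s) ⟩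
  suc s * (suc (suc (s + s)) * (suc (s + s) C s))  ≡⟨ cong (λ x → suc s * (suc (suc (s + s)) * x)) symmetric ⟩
  suc s * (suc (suc (s + s)) * (suc (s + s) C suc s)) ≡⟨ rearrange s (suc (s + s) C suc s) ⟩
  suc s * (2 * (suc s * (suc (s + s) C suc s)))    ≡⟨ cong (λ x → suc s * (2 * x)) (absorption (s + s) s) ⟩
  suc s * (2 * (suc (s + s) * ((s + s) C s)))      ∎)
  where
  open ≡-Reasoning
  symmetric : suc (s + s) C s ≡ suc (s + s) C suc s
  symmetric = trans (nCk≡nC[n∸k] (m≤n⇒m≤1+n (m≤m+n s s)))
    (cong (suc (s + s) C_) (trans (cong (_∸ s) (sym (+-suc s s))) (m+n∸m≡n s (suc s))))
  rearrange : ∀ s x → suc s * (suc (suc (s + s)) * x) ≡ suc s * (2 * (suc s * x))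
  rearrange = solve-∀

-- Equality holds at `s = 1`; each induction step only gives away the difference between `s + s` and
-- `suc (s + s)` in the recurrence.
4^s≤2*s*centralBinomial : ∀ s → .{{NonZero s}} → 4 ^ s ≤ 2 * (s * ((s + s) C s))
4^s≤2*s*centralBinomial (suc zero)      = ≤-refl
4^s≤2*s*centralBinomial (suc s@(suc _)) = begin
  4 * 4 ^ s                                ≤⟨ *-monoʳ-≤ 4 (4^s≤2*s*centralBinomial s) ⟩
  4 * (2 * (s * c))                        ≡⟨ rearrange s c ⟩
  2 * (2 * ((s + s) * c))                  ≤⟨ *-monoʳ-≤ 2 (*-monoʳ-≤ 2 (*-monoˡ-≤ c (n≤1+n (s + s)))) ⟩
  2 * (2 * (suc (s + s) * c))              ≡⟨ cong (2 *_) (centralBinomial-suc s) ⟨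
  2 * (suc s * ((suc s + suc s) C suc s))  ∎
  where
  open ≤-Reasoning
  c = (s + s) C s
  rearrange : ∀ s c → 4 * (2 * (s * c)) ≡ 2 * (2 * ((s + s) * c))
  rearrange = solve-∀

-- The window from `2n` to `8n` spans a factor of four. As `n` grows, `s` is kept while it is large
-- enough; once `4 ^ s < 2 * suc n`, the next power is still at most `8 * suc n`.
powerOfFour : ∀ n → .{{NonZero n}} → ∃[ s ] (NonZero s × 2 * n ≤ 4 ^ s × 4 ^ s ≤ 8 * n)
powerOfFour (suc zero) = 1 , _ , m≤m+n 2 2 , m≤m+n 4 4
powerOfFour (suc n@(suc _)) with s , s≢0 , lower , upper ← powerOfFour n | 2 * suc n ≤? 4 ^ s
... | yes 2n≤ = s , s≢0 , 2n≤ , ≤-trans upper (*-monoʳ-≤ 8 (n≤1+n n))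
... | no  2n≰ = suc s , _ , lower′ , upper′
  where
  open ≤-Reasoning
  lower′ : 2 * suc n ≤ 4 * 4 ^ s
  lower′ = begin
    2 * suc n     ≤⟨ *-monoʳ-≤ 2 (s≤s (m≤n+m n _)) ⟩
    2 * (n + n)   ≡⟨ rearrange n ⟩
    2 * (2 * n)   ≤⟨ *-mono-≤ (m≤m+n 2 2) lower ⟩
    4 * 4 ^ s     ∎
    where
    rearrange : ∀ n → 2 * (n + n) ≡ 2 * (2 * n)
    rearrange = solve-∀
  upper′ : 4 * 4 ^ s ≤ 8 * suc n
  upper′ = begin
    4 * 4 ^ s        ≤⟨ *-monoʳ-≤ 4 (<⇒≤ (≰⇒> 2n≰)) ⟩
    4 * (2 * suc n)  ≡⟨ *-assoc 4 2 (suc n) ⟨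
    8 * suc n        ∎

m*n≤o⇒m≤o/n : ∀ m n o .{{_ : NonZero n}} → m * n ≤ o → m ≤ o / n
m*n≤o⇒m≤o/n m n o m*n≤o = subst (_≤ o / n) (m*n/n≡m m n) (/-monoˡ-≤ n m*n≤o)

^-distrib-* : ∀ m n o → (m * n) ^ o ≡ m ^ o * n ^ o
^-distrib-* m n zero    = refl
^-distrib-* m n (suc o) = trans (cong (m * n *_) (^-distrib-* m n o)) ([m*n]*[o*p]≡[m*o]*[n*p] m n (m ^ o) (n ^ o))

-- The menu strategy

-- Repetitions are kept, so that the length is the size of the class and `Unique` expresses that its
-- hues are distinct.
hues : ℕ → Vec ℕ m → Vec ℕ m → List ℕ
hues b []        []       = []
hues b (a ∷ alg) (p ∷ pr) with b ≟ a
... | yes _ = p ∷ hues b alg pr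
... | no  _ = hues b alg pr

length-hues : ∀ b (alg pr : Vec ℕ m) → length (hues b alg pr) ≡ count (b ≟_) alg
length-hues b []        []       = refl
length-hues b (a ∷ alg) (p ∷ pr) with b ≟ a
... | yes b≡a = trans (cong suc (length-hues b alg pr)) (sym (count-accept (b ≟_) alg b≡a))
... | no  b≢a = trans (length-hues b alg pr) (sym (count-reject (b ≟_) alg b≢a))

∈-hues⁻ : ∀ {x} b (alg pr : Vec ℕ m) → x ∈ hues b alg pr → ∃[ i ] (lookup alg i ≡ b × lookup pr i ≡ x)
∈-hues⁻ b []        []       ()
∈-hues⁻ b (a ∷ alg) (p ∷ pr) x∈ with b ≟ a | x∈
... | yes b≡a | here x≡p = zero , sym b≡a , sym x≡p
... | yes _   | there x∈′ with i , eq ← ∈-hues⁻ b alg pr x∈′ = suc i , eq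
... | no _    | x∈′       with i , eq ← ∈-hues⁻ b alg pr x∈′ = suc i , eq

Proper-▹ : ∀ {G : Graph m} {N c x} → Proper G c → (∀ j → j Subset.∈ N → x ≢ lookup c j) → Proper (G ▹ N) (x ∷ c)
Proper-▹ proper new zero    (suc j) adj = new j adj
Proper-▹ proper new (suc i) zero    adj = new i adj ∘ sym
Proper-▹ proper new (suc i) (suc j) adj = proper i j adj

-- One direction of the membership criterion makes every menu colour proper for Presenter; the other
-- bars Algorithm from reusing a class that has a hue off the menu.
colouredOutside : List ℕ → Vec ℕ m → Subset.Subset m
colouredOutside M = Vec.map (λ p → not (does (p ∈? M)))

∈-colouredOutside⁻ : ∀ {M} (c : Vec ℕ m) {j} → j Subset.∈ colouredOutside M c → lookup c j ∉ M
∈-colouredOutside⁻ {M = M} c {j} j∈ cj∈M = case trans (sym ([]=⇒lookup j∈)) eq of λ ()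
  where
  eq : lookup (colouredOutside M c) j ≡ false
  eq = trans (lookup-map j _ c) (cong not (dec-true (_ ∈? M) cj∈M))

∈-colouredOutside⁺ : ∀ {M} (c : Vec ℕ m) {j} → lookup c j ∉ M → j Subset.∈ colouredOutside M c
∈-colouredOutside⁺ {M = M} c {j} cj∉M =
  lookup⇒[]= j _ (trans (lookup-map j _ c) (cong not (dec-false (_ ∈? M) cj∉M)))

module Game (n k s : ℕ) .{{_ : NonZero k}} .{{_ : NonZero s}} (n≤menus : n ≤ ((s + s) C s) * s) where

  bound : ℕ
  bound = n / k + (s + s)

  Usable : Vec ℕ m → ℕ → Set
  Usable pr p = count (p ≟_) pr < k

  usable? : (pr : Vec ℕ m) → Decidable (Usable pr)
  usable? pr p = count (p ≟_) pr <? k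

  palette : Vec ℕ m → List ℕ
  palette pr = take (s + s) (filter (usable? pr) (upTo bound))

  menus : Vec ℕ m → List (List ℕ)
  menus pr = choose s (palette pr)

  Exhausts : (alg pr : Vec ℕ m) → List ℕ → ℕ → Set
  Exhausts alg pr M a = All (_∈ hues a alg pr) M

  -- Quantifying over the colours already used makes this decidable; `free⇒¬exhausts` extends it to
  -- all colours.
  Free : (alg pr : Vec ℕ m) → List ℕ → Set
  Free alg pr M = ¬ Any (Exhausts alg pr M) (toList alg)

  free? : (alg pr : Vec ℕ m) → Decidable (Free alg pr)
  free? alg pr M = ¬? (any? (λ a → all? (λ p → p ∈? (hues a alg pr)) M) (toList alg))

  menu : (alg pr : Vec ℕ m) → List ℕ
  menu alg pr = pick (free? alg pr) [] (menus pr)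

  hue : (alg pr : Vec ℕ m) → ℕ → ℕ
  hue alg pr a = pick (λ p → ¬? (p ∈? (hues a alg pr))) 0 (menu alg pr)

  presenterStrategy : Strategy
  presenterStrategy .present P = colouredOutside (menu (algorithm P) (presenter P)) (presenter P)
  presenterStrategy .reply   P = hue (algorithm P) (presenter P)

  -- Existence of a free menu.

  palette⊆ : (pr : Vec ℕ m) → palette pr ⊆ filter (usable? pr) (upTo bound)
  palette⊆ pr = take-⊆ (s + s) _

  palette-! : (pr : Vec ℕ m) → Unique (palette pr)
  palette-! pr = Unique.take⁺ (s + s) (Unique.filter⁺ (usable? pr) (Unique.upTo⁺ bound))

  -- Each unusable colour already has `k` vertices, so at most `n / k` of the `bound` colours are
  -- unusable. Truncation then makes the length exact, and so also the number of menus.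
  length-palette : (pr : Vec ℕ m) → m ≤ n → length (palette pr) ≡ s + s
  length-palette {m} pr m≤n = trans (length-take (s + s) usable) (m≤n⇒m⊓n≡m enough)
    where
    open ≤-Reasoning
    usable unusable : List ℕ
    usable   = filter (usable? pr) (upTo bound)
    unusable = filter (¬? ∘ usable? pr) (upTo bound)
    few : length unusable ≤ n / k
    few = m*n≤o⇒m≤o/n (length unusable) k n (≤-trans
      (pigeonhole-≥ pr (Unique.filter⁺ (¬? ∘ usable? pr) (Unique.upTo⁺ bound))
        (All.map ≮⇒≥ (All.all-filter (¬? ∘ usable? pr) (upTo bound)))) m≤n)
    enough : s + s ≤ length usable
    enough = +-cancelˡ-≤ (n / k) _ _ (begin
      bound                            ≡⟨ length-upTo bound ⟨
      length (upTo bound)              ≡⟨ length-filter-¬ (usable? pr) (upTo bound) ⟨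
      length usable + length unusable  ≤⟨ +-monoʳ-≤ (length usable) few ⟩
      length usable + n / k            ≡⟨ +-comm (length usable) (n / k) ⟩
      n / k + length usable            ∎)

  HuesBounded : (alg pr : Vec ℕ m) → Set
  HuesBounded alg pr = ∀ b → Unique (hues b alg pr) × length (hues b alg pr) ≤ s

  -- If every menu were exhausted, choosing an exhausting class for each would give as many distinct
  -- classes as menus, each with at least `s` vertices. That makes at least `n` vertices, but only
  -- `m < n` have been presented.
  freeMenuExists : (alg pr : Vec ℕ m) → m < n → HuesBounded alg pr → Any (Free alg pr) (menus pr)
  freeMenuExists {m} alg pr m<n bounded = decidable-stable (any? (free? alg pr) (menus pr)) λ noneFree →
    let classes , eq , full = All-∃-map (All.map full (All.zip (choose-sublists s (palette pr) , blocked noneFree)))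
        -- `menuOf` recovers each menu from its chosen class, so distinct menus have distinct
        -- classes.
        classes!            = Unique.map⁻ (subst Unique (sym eq) (choose-! s (palette-! pr)))
        number              = begin-equality
          length classes                 ≡⟨ length-map menuOf classes ⟨
          length (map menuOf classes)    ≡⟨ cong length eq ⟩
          length (menus pr)              ≡⟨ length-choose s (palette pr) ⟩
          length (palette pr) C s        ≡⟨ cong (_C s) (length-palette pr (<⇒≤ m<n)) ⟩
          (s + s) C s                    ∎
    in <-irrefl refl (begin-strict
      m                    <⟨ m<n ⟩
      n                    ≤⟨ n≤menus ⟩
      ((s + s) C s) * s    ≡⟨ cong (_* s) number ⟨
      length classes * s   ≤⟨ pigeonhole-≥ alg classes! full ⟩
      m                    ∎)
    where
    open ≤-Reasoning
    menuOf : ℕ → List ℕ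
    menuOf a = filter (λ p → p ∈? (hues a alg pr)) (palette pr)
    blocked : ¬ Any (Free alg pr) (menus pr) → All (λ M → Any (Exhausts alg pr M) (toList alg)) (menus pr)
    blocked noneFree = All.map (λ {M} → decidable-stable (any? (λ a → all? (λ p → p ∈? (hues a alg pr)) M) (toList alg)))
      (All.¬Any⇒All¬ (menus pr) noneFree)
    full : ∀ {M} → (M ⊆ palette pr × length M ≡ s) × Any (Exhausts alg pr M) (toList alg) →
      ∃[ a ] (menuOf a ≡ M × s ≤ count (a ≟_) alg)
    full {M} ((M⊆ , refl) , any) with a , _ , M⊆hues ← find any =
      a , sym M≡ , (begin
        length M                       ≤⟨ unique⇒length≤ (subst Unique (sym M≡) (Unique.filter⁺ _ (palette-! pr))) M⊆hues ⟩
        length (hues a alg pr)         ≡⟨ length-hues a alg pr ⟩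
        count (a ≟_) alg               ∎)
      where
      M≡ : M ≡ menuOf a
      M≡ = sublist≡filter (palette-! pr) M⊆ M⊆hues (proj₂ (bounded a))

  menu-free : (alg pr : Vec ℕ m) → m < n → HuesBounded alg pr → menu alg pr ∈ menus pr × Free alg pr (menu alg pr)
  menu-free alg pr m<n bounded = pick-sat (free? alg pr) [] (freeMenuExists alg pr m<n bounded)

  length-menu : (alg pr : Vec ℕ m) → m < n → HuesBounded alg pr → length (menu alg pr) ≡ s
  length-menu alg pr m<n bounded =
    proj₂ (All.lookup (choose-sublists s (palette pr)) (proj₁ (menu-free alg pr m<n bounded)))

  -- As `s` is positive, a menu has an entry; a class exhausting it therefore contains a vertex, and
  -- its colour is among those already used.
  free⇒¬exhausts : ∀ (alg pr : Vec ℕ m) a {M} → length M ≡ s → Free alg pr M → ¬ Exhausts alg pr M a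
  free⇒¬exhausts alg pr a {[]}    0≡s _    _                  = ≢-nonZero⁻¹ s (sym 0≡s)
  free⇒¬exhausts alg pr a {p ∷ M} _   free exhausts@(p∈ ∷ _) with i , refl , _ ← ∈-hues⁻ a alg pr p∈ =
    free (lose (∈-toList⁺ (∈-lookup i alg)) exhausts)

  hue-fresh : (alg pr : Vec ℕ m) → m < n → HuesBounded alg pr → ∀ a →
    hue alg pr a ∈ menu alg pr × hue alg pr a ∉ hues a alg pr
  hue-fresh alg pr m<n bounded a =
    pick-sat _ 0 (All.¬All⇒Any¬ (λ p → p ∈? (hues a alg pr)) (menu alg pr)
      (free⇒¬exhausts alg pr a (length-menu alg pr m<n bounded) (proj₂ (menu-free alg pr m<n bounded))))

  hue-usable : (alg pr : Vec ℕ m) → m < n → HuesBounded alg pr → ∀ a →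
    hue alg pr a < bound × Usable pr (hue alg pr a)
  hue-usable alg pr m<n bounded a
    with menu⊆ , _ ← All.lookup (choose-sublists s (palette pr)) (proj₁ (menu-free alg pr m<n bounded))
    with ∈upTo , usable ← ∈-filter⁻ (usable? pr) {xs = upTo bound}
      (Sublist.lookup (palette⊆ pr) (Sublist.lookup menu⊆ (proj₁ (hue-fresh alg pr m<n bounded a)))) =
    ∈-upTo⁻ ∈upTo , usable

  -- The invariant of the play.

  record Invariant (P : Position m) : Set where
    field
      huesBounded : HuesBounded (algorithm P) (presenter P)
      valid       : KBounded k (graph P) (presenter P)
      colours<    : ∀ i → lookup (presenter P) i < bound

  open Invariant

  -- `huesBounded` feeds itself: it guarantees a free menu in the next round, whose fresh hue
  -- preserves it. In the case of `round` the bound on the number of rounds becomes the strict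
  -- inequality needed for that menu to exist.
  invariant : ∀ {P : Position m} → m ≤ n → Play k presenterStrategy P → Invariant P
  invariant m≤n start = record
    { huesBounded = λ _ → [] , z≤n
    ; valid       = (λ ()) , (λ _ → z≤n)
    ; colours<    = λ ()
    }
  invariant m<n (round {P = P} play a (properAlg , _)) = record
    { huesBounded = huesBounded′
    ; valid       = Proper-▹ (proj₁ (valid ih)) newProper , newBounded
    ; colours<    = λ { zero → proj₁ usable ; (suc i) → colours< ih i }
    }
    where
    alg = algorithm P
    pr  = presenter P
    ih  = invariant (<⇒≤ m<n) play
    bounded = huesBounded ih
    p      = hue alg pr a
    fresh  = hue-fresh alg pr m<n bounded a
    usable = hue-usable alg pr m<n bounded a

    newProper : ∀ j → j Subset.∈ present presenterStrategy P → p ≢ lookup pr j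
    newProper j j∈ p≡ = ∈-colouredOutside⁻ pr j∈ (subst (_∈ menu alg pr) p≡ (proj₁ fresh))

    newBounded : ∀ c → count (c ≟_) (p ∷ pr) ≤ k
    newBounded c with c ≟ p
    ... | yes refl = subst (_≤ k) (sym (count-accept (p ≟_) pr refl)) (proj₂ usable)
    ... | no c≢p   = subst (_≤ k) (sym (count-reject (c ≟_) pr c≢p)) (proj₂ (valid ih) c)

    -- A vertex of class `a` with a hue off the menu would be adjacent to the new vertex and share
    -- its Algorithm colour.
    hues⊆menu : All (_∈ menu alg pr) (hues a alg pr)
    hues⊆menu = All.tabulate λ {x} x∈ → let i , a≡ , x≡ = ∈-hues⁻ a alg pr x∈ in
      decidable-stable (x ∈? (menu alg pr)) λ x∉ →
        properAlg zero (suc i) (∈-colouredOutside⁺ pr (subst (_∉ menu alg pr) (sym x≡) x∉)) (sym a≡)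

    huesBounded′ : HuesBounded (a ∷ alg) (p ∷ pr)
    huesBounded′ b with b ≟ a
    ... | no _     = bounded b
    -- The enlarged class still has distinct hues, all on one menu of `s` colours, hence at most `s`
    -- of them.
    ... | yes refl = new! , ≤-trans (unique⇒length≤ new! (proj₁ fresh ∷ hues⊆menu))
                                    (≤-reflexive (length-menu alg pr m<n bounded))
      where
      new! : Unique (p ∷ hues b alg pr)
      new! = All.¬Any⇒All¬ _ (proj₂ fresh) ∷ proj₁ (bounded b)

  -- The transparent strategy and the colour counts.

  transparent : TransparentStrategy n k
  transparent = record
    { strategy = presenterStrategy
    ; valid    = λ m≤n play → valid (invariant m≤n play)
    }

  algorithm-≥ : ∀ {P} → Play k presenterStrategy P → n ≤ numColours (algorithm P) * s
  algorithm-≥ {P} play = pigeonhole-≤ _ alg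
    (λ i → ∈-deduplicate⁺ _≟_ (∈-toList⁺ (∈-lookup i alg)))
    (λ a → subst (_≤ s) (length-hues a alg _) (proj₂ (huesBounded (invariant ≤-refl play) a)))
    where alg = algorithm P

  presenter-≤ : ∀ {P} → Play k presenterStrategy P → numColours (presenter P) ≤ n / k + (s + s)
  presenter-≤ {P} play = subst (numColours pr ≤_) (length-upTo bound) (unique⇒length≤
    (deduplicate-! _≟_ (toList pr))
    (All.tabulate λ x∈ → ∈-upTo⁺ (below pr (colours< (invariant ≤-refl play)) (∈-deduplicate⁻ _≟_ (toList pr) x∈))))
    where
    pr = presenter P
    below : ∀ {m x} (c : Vec ℕ m) → (∀ i → lookup c i < bound) → x ∈ toList c → x < bound
    below (_ ∷ _) c< (here refl) = c< zero
    below (_ ∷ c) c< (there x∈)  = below c (c< ∘ suc) x∈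

-- Bounds in terms of the logarithm

fromℕ-mono-≤ : ∀ {i j} → i ≤ j → fromℕ i ℚ.≤ fromℕ j
fromℕ-mono-≤ i≤j = *≤* (ℤ.*-monoʳ-≤-nonNeg (ℤ.+ 1) (+≤+ i≤j))

fromℕ-+ : ∀ i j → fromℕ (i + j) ℚ.≃ fromℕ i ℚ.+ fromℕ j
fromℕ-+ i j = ℚ.*≡* (cong (ℤ._* ℤ.+ 1) (sym (cong₂ ℤ._+_ (ℤ.*-identityʳ (ℤ.+ i)) (ℤ.*-identityʳ (ℤ.+ j)))))

fromℕ-* : ∀ i j → fromℕ (i * j) ℚ.≃ fromℕ i ℚ.* fromℕ j
fromℕ-* i j = ℚ.*≡* (cong (ℤ._* ℤ.+ 1) (ℤ.pos-* i j))

fromℕ-/-≤ : ∀ n k .{{_ : NonZero k}} → fromℕ (n / k) ℚ.≤ ℤ.+ n ℚ./ k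
fromℕ-/-≤ n k@(suc _) = *≤* (subst₂ ℤ._≤_ (ℤ.pos-* (n / k) k) (sym (ℤ.*-identityʳ (ℤ.+ n))) (+≤+ (m/n*n≤m n k)))

-- For `q = a / b` the hypothesis on the logarithm reads `n ^ b ≤ 2 ^ a`. Raising `4 ^ s ≤ 8 * n` to
-- the power `b` and comparing exponents of two gives the claim with denominators cleared; the 3 is
-- the logarithm of 8.
4^s≤8n⇒2s≤q+3 : ∀ {n s} q → .{{ℚ.NonNegative q}} → log₂ n ≤ q → 4 ^ s ≤ 8 * n →
  fromℕ (s + s) ℚ.≤ q ℚ.+ fromℕ 3
4^s≤8n⇒2s≤q+3 {n} {s} (mkℚᵘ (ℤ.+ a) b-1) n^b≤2^a 4^s≤8n =
  *≤* (subst₂ ℤ._≤_ lhs rhs (+≤+ exponents))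
  where
  open ≤-Reasoning
  b = suc b-1
  powers : 2 ^ ((s + s) * b) ≤ 2 ^ (a + 3 * b)
  powers = begin
    2 ^ ((s + s) * b)    ≡⟨ ^-*-assoc 2 (s + s) b ⟨
    (2 ^ (s + s)) ^ b    ≡⟨ cong (_^ b) (trans (cong (2 ^_) (cong (λ x → s + x) (sym (+-identityʳ s)))) (sym (^-*-assoc 2 2 s))) ⟩
    (4 ^ s) ^ b          ≤⟨ ^-monoˡ-≤ b 4^s≤8n ⟩
    (8 * n) ^ b          ≡⟨ ^-distrib-* 8 n b ⟩
    8 ^ b * n ^ b        ≤⟨ *-monoʳ-≤ (8 ^ b) n^b≤2^a ⟩
    8 ^ b * 2 ^ a        ≡⟨ cong (_* 2 ^ a) (^-*-assoc 2 3 b) ⟩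
    2 ^ (3 * b) * 2 ^ a  ≡⟨ ^-distribˡ-+-* 2 (3 * b) a ⟨
    2 ^ (3 * b + a)      ≡⟨ cong (2 ^_) (+-comm (3 * b) a) ⟩
    2 ^ (a + 3 * b)      ∎
  exponents : (s + s) * b ≤ a + 3 * b
  exponents = ≮⇒≥ λ lt → <⇒≱ (^-monoʳ-< 2 (s≤s (s≤s z≤n)) lt) powers
  -- `b * 1` is the denominator that unnormalised addition gives to `q ℚ.+ fromℕ 3`.
  lhs : ℤ.+ ((s + s) * b) ≡ ℤ.+ (s + s) ℤ.* ℤ.+ (b * 1)
  lhs = trans (cong (λ x → ℤ.+ ((s + s) * x)) (sym (*-identityʳ b))) (ℤ.pos-* (s + s) (b * 1))
  rhs : ℤ.+ (a + 3 * b) ≡ (ℤ.+ a ℤ.* ℤ.+ 1 ℤ.+ ℤ.+ 3 ℤ.* ℤ.+ b) ℤ.* ℤ.+ 1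
  rhs = sym (trans (ℤ.*-identityʳ _) (cong₂ ℤ._+_ (ℤ.*-identityʳ (ℤ.+ a)) refl))

nonNeg+3-positive : ∀ q → .{{ℚ.NonNegative q}} → ℚ.Positive (q ℚ.+ fromℕ 3)
nonNeg+3-positive (mkℚᵘ (ℤ.+ zero)  _) = _
nonNeg+3-positive (mkℚᵘ (ℤ.+ suc _) _) = _

-- From `2 * n ≤ c * (s + s)` and `2s ≤ d` follows `2n ≤ c d`, and the positive `d` is divided out.
n≤c*s⇒algorithmBound≤c : ∀ n c s q .{{_ : ℚ.NonNegative q}} → n ≤ c * s → fromℕ (s + s) ℚ.≤ q ℚ.+ fromℕ 3 →
  algorithmBound n q ℚ.≤ fromℕ c
n≤c*s⇒algorithmBound≤c n c s q@record{} n≤c*s 2s≤q+3 = begin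
  fromℕ 2 ℚ.* (fromℕ n ℚ.* 1/d)    ≃⟨ ℚ.*-assoc (fromℕ 2) (fromℕ n) 1/d ⟨
  fromℕ 2 ℚ.* fromℕ n ℚ.* 1/d      ≤⟨ ℚ.*-monoˡ-≤-nonNeg 1/d {{ℚ.pos⇒nonNeg 1/d}} numerator ⟩
  fromℕ c ℚ.* d ℚ.* 1/d            ≃⟨ ℚ.*-assoc (fromℕ c) d 1/d ⟩
  fromℕ c ℚ.* (d ℚ.* 1/d)          ≃⟨ ℚ.*-congˡ {fromℕ c} (ℚ.*-inverseʳ d) ⟩
  fromℕ c ℚ.* ℚ.1ℚᵘ                ≃⟨ ℚ.*-identityʳ (fromℕ c) ⟩
  fromℕ c                          ∎
  where
  open ℚ.≤-Reasoning
  d = q ℚ.+ fromℕ 3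
  instance
    d>0 : ℚ.Positive d
    d>0 = nonNeg+3-positive q
    d≢0 : ℚ.NonZero d
    d≢0 = ℚ.pos⇒nonZero d
  1/d = ℚ.1/ d
  instance
    1/d>0 : ℚ.Positive 1/d
    1/d>0 = ℚ.1/pos⇒pos d
  2n≤ : 2 * n ≤ c * (s + s)
  2n≤ = ≤-trans (*-monoʳ-≤ 2 n≤c*s) (≤-reflexive (rearrange c s))
    where
    rearrange : ∀ c s → 2 * (c * s) ≡ c * (s + s)
    rearrange = solve-∀
  numerator : fromℕ 2 ℚ.* fromℕ n ℚ.≤ fromℕ c ℚ.* d
  numerator = begin
    fromℕ 2 ℚ.* fromℕ n           ≃⟨ fromℕ-* 2 n ⟨
    fromℕ (2 * n)                 ≤⟨ fromℕ-mono-≤ 2n≤ ⟩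
    fromℕ (c * (s + s))           ≃⟨ fromℕ-* c (s + s) ⟩
    fromℕ c ℚ.* fromℕ (s + s)     ≤⟨ ℚ.*-monoʳ-≤-nonNeg (fromℕ c) 2s≤q+3 ⟩
    fromℕ c ℚ.* d                 ∎

c≤n/k+2s⇒c≤presenterBound : ∀ n k c s q .{{_ : NonZero k}} → c ≤ n / k + (s + s) →
  fromℕ (s + s) ℚ.≤ q ℚ.+ fromℕ 3 → fromℕ c ℚ.≤ presenterBound n k q
c≤n/k+2s⇒c≤presenterBound n k c s q c≤ 2s≤q+3 = begin
  fromℕ c                                ≤⟨ fromℕ-mono-≤ c≤ ⟩
  fromℕ (n / k + (s + s))                ≃⟨ fromℕ-+ (n / k) (s + s) ⟩
  fromℕ (n / k) ℚ.+ fromℕ (s + s)        ≤⟨ ℚ.+-mono-≤ (fromℕ-/-≤ n k) 2s≤q+3 ⟩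
  ℤ.+ n ℚ./ k ℚ.+ (q ℚ.+ fromℕ 3)          ≃⟨ ℚ.+-assoc (ℤ.+ n ℚ./ k) q (fromℕ 3) ⟨
  ℤ.+ n ℚ./ k ℚ.+ q ℚ.+ fromℕ 3            ∎
  where open ℚ.≤-Reasoning

theorem1 : (n k : ℕ) → .{{_ : NonZero k}} → 2 ≤ n →
    Σ[ σ ∈ TransparentStrategy n k ]
    (∀ (P : Position n) → Play k (strategy σ) P →
    AlgorithmAtLeast n (numColours (algorithm P)) ×
    PresenterAtMost n k (numColours (presenter P)))
theorem1 n@(suc _) k 2≤n with s , s≢0 , 2n≤4^s , 4^s≤8n ← powerOfFour n = transparent , λ P play →
  (λ q log≤q → n≤c*s⇒algorithmBound≤c n _ s q (algorithm-≥ play) (4^s≤8n⇒2s≤q+3 {n} {s} q log≤q 4^s≤8n)) ,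
  (λ q log≤q → c≤n/k+2s⇒c≤presenterBound n k _ s q (presenter-≤ play) (4^s≤8n⇒2s≤q+3 {n} {s} q log≤q 4^s≤8n))
  where
  instance
    _ : NonZero s
    _ = s≢0
  -- Half of `2 * n ≤ 4 ^ s ≤ 2 * (s * ((s + s) C s))`: this is where the lower end of the window
  -- for `4 ^ s` enters.
  n≤menus : n ≤ ((s + s) C s) * s
  n≤menus = *-cancelˡ-≤ 2 (≤-trans 2n≤4^s (≤-trans (4^s≤2*s*centralBinomial s)
    (≤-reflexive (cong (2 *_) (*-comm s ((s + s) C s))))))
  open Game n k s n≤menus
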